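{- Let $A_1,\dots,A_n,B$ be pure propositions. If $A_1,\dots,A_n\vdash B$ holds in classical propositional logic, then $A_1^\oplus,\dots,A_n^\oplus\vdash B^\oplus$ holds in $\textsc{prk}$.
   Context: **Propositions.** Fix a denumerable set of propositional variables $\alpha,\beta,\dots$. Pure propositions: $A,B ::= \alpha \mid A\land B\mid A\lor B\mid \neg A$. (Moded) propositions: $P,Q ::= A^+\mid A^-\mid A^\oplus\mid A^\ominus$ with $A$ pure; $A^+,A^-$ are strong, $A^\oplus,A^\ominus$ are classical. The opposite $P^\sim$ is: $(A^+)^\sim=A^-$, $(A^-)^\sim=A^+$, $(A^\oplus)^\sim=A^\ominus$, $(A^\ominus)^\sim=A^\oplus$. **System $\textsc{prk}$.** Judgments $\Gamma\vdash P$ with $\Gamma$ a finite set of propositions ($\Gamma,P$ means $\Gamma\cup\{P\}$), derivable by the rules (for $i\in\{1,2\}$): - (Ax) $\Gamma,P\vdash P$. (Abs) From $\Gamma\vdash P$ and $\Gamma\vdash P^\sim$ with $P$ strong, infer $\Gamma\vdash Q$ (any $Q$). - (I$\land^+$) From $\Gamma\vdash A^\oplus$ and $\Gamma\vdash B^\oplus$ infer $\Gamma\vdash(A\land B)^+$. (I$\lor^-$) From $\Gamma\vdash A^\ominus$ and $\Gamma\vdash B^\ominus$ infer $\Gamma\vdash(A\lor B)^-$. - (E$\land^+_i$) From $\Gamma\vdash(A_1\land A_2)^+$ infer $\Gamma\vdash A_i^\oplus$. (E$\lor^-_i$) From $\Gamma\vdash(A_1\lor A_2)^-$ infer $\Gamma\vdash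 A_i^\ominus$. - (I$\lor^+_i$) From $\Gamma\vdash A_i^\oplus$ infer $\Gamma\vdash(A_1\lor A_2)^+$. (I$\land^-_i$) From $\Gamma\vdash A_i^\ominus$ infer $\Gamma\vdash(A_1\land A_2)^-$. - (E$\lor^+$) From $\Gamma\vdash(A\lor B)^+$, $\Gamma,A^\oplus\vdash P$ and $\Gamma,B^\oplus\vdash P$ infer $\Gamma\vdash P$. (E$\land^-$) From $\Gamma\vdash(A\land B)^-$, $\Gamma,A^\ominus\vdash P$ and $\Gamma,B^\ominus\vdash P$ infer $\Gamma\vdash P$. - (I$\neg^+$) From $\Gamma\vdash A^\ominus$ infer $\Gamma\vdash(\neg A)^+$. (I$\neg^-$) From $\Gamma\vdash A^\oplus$ infer $\Gamma\vdash(\neg A)^-$. (E$\neg^+$) From $\Gamma\vdash(\neg A)^+$ infer $\Gamma\vdash A^\ominus$. (E$\neg^-$) From $\Gamma\vdash(\neg A)^-$ infer $\Gamma\vdash A^\oplus$. - (IC$^+$) From $\Gamma,A^\ominus\vdash A^+$ infer $\Gamma\vdash A^\oplus$. (IC$^-$) From $\Gamma,A^\oplus\vdash A^-$ infer $\Gamma\vdash A^\ominus$. - (EC$^+$) From $\Gamma\vdash A^\oplus$ and $\Gamma\vdash A^\ominus$ infer $\Gamma\vdash A^+$. (EC$^-$) From $\Gamma\vdash A^\ominus$ and $\Gamma\vdash A^\oplus$ infer $\Gamma\vdash A^-$. -}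

module Defs where

open import Data.Nat.Base using (ℕ)
open import Data.List.Base using (List; _∷_)
open import Data.List.Membership.Propositional using (_∈_)

infixr 8 _∧_
infixr 7 _∨_
infix  9 ¬_
infix  6 _⁺ _⁻ _⊕ _⊖ _∼
infix  3 _⊢ᶜ_ _⊢ᵖʳᵏ_

data Pure : Set where
  var     : ℕ → Pure
  _∧_ _∨_ : Pure → Pure → Pure
  ¬_      : Pure → Pure

data Proposition : Set where
  _⁺ _⁻ : Pure → Proposition
  _⊕ _⊖ : Pure → Proposition

data Strong : Proposition → Set where
  strong⁺ : ∀ {A} → Strong (A ⁺)
  strong⁻ : ∀ {A} → Strong (A ⁻)

_∼ : Proposition → Proposition
(A ⁺) ∼ = A ⁻
(A ⁻) ∼ = A ⁺
(A ⊕) ∼ = A ⊖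
(A ⊖) ∼ = A ⊕

-- In both calculi a finite set of hypotheses is represented by a list, with
-- Γ ∪ {P} as P ∷ Γ. The rules inspect a context only through membership (in
-- ax), so derivability depends only on the set of members: order and
-- repetitions are irrelevant.

-- Classical propositional logic as natural deduction: the usual introduction
-- and elimination rules, plus excluded middle. There is no falsum in the
-- language, so an absurdity is a pair of derivations of B and ¬ B.
data _⊢ᶜ_ (Γ : List Pure) : Pure → Set where
  ax  : ∀ {A} → A ∈ Γ → Γ ⊢ᶜ A
  ∧I  : ∀ {A B} → Γ ⊢ᶜ A → Γ ⊢ᶜ B → Γ ⊢ᶜ A ∧ B
  ∧E₁ : ∀ {A B} → Γ ⊢ᶜ A ∧ B → Γ ⊢ᶜ A
  ∧E₂ : ∀ {A B} → Γ ⊢ᶜ A ∧ B → Γ ⊢ᶜ B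
  ∨I₁ : ∀ {A B} → Γ ⊢ᶜ A → Γ ⊢ᶜ A ∨ B
  ∨I₂ : ∀ {A B} → Γ ⊢ᶜ B → Γ ⊢ᶜ A ∨ B
  ∨E  : ∀ {A B C} → Γ ⊢ᶜ A ∨ B → A ∷ Γ ⊢ᶜ C → B ∷ Γ ⊢ᶜ C → Γ ⊢ᶜ C
  ¬I  : ∀ {A B} → A ∷ Γ ⊢ᶜ B → A ∷ Γ ⊢ᶜ ¬ B → Γ ⊢ᶜ ¬ A
  ¬E  : ∀ {A B} → Γ ⊢ᶜ A → Γ ⊢ᶜ ¬ A → Γ ⊢ᶜ B
  lem : ∀ {A} → Γ ⊢ᶜ A ∨ ¬ A

data _⊢ᵖʳᵏ_ (Γ : List Proposition) : Proposition → Set where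
  ax   : ∀ {P} → P ∈ Γ → Γ ⊢ᵖʳᵏ P
  abs  : ∀ {P Q} → Strong P → Γ ⊢ᵖʳᵏ P → Γ ⊢ᵖʳᵏ P ∼ → Γ ⊢ᵖʳᵏ Q
  I∧⁺  : ∀ {A B} → Γ ⊢ᵖʳᵏ A ⊕ → Γ ⊢ᵖʳᵏ B ⊕ → Γ ⊢ᵖʳᵏ (A ∧ B) ⁺
  I∨⁻  : ∀ {A B} → Γ ⊢ᵖʳᵏ A ⊖ → Γ ⊢ᵖʳᵏ B ⊖ → Γ ⊢ᵖʳᵏ (A ∨ B) ⁻
  E∧⁺₁ : ∀ {A B} → Γ ⊢ᵖʳᵏ (A ∧ B) ⁺ → Γ ⊢ᵖʳᵏ A ⊕
  E∧⁺₂ : ∀ {A B} → Γ ⊢ᵖʳᵏ (A ∧ B) ⁺ → Γ ⊢ᵖʳᵏ B ⊕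
  E∨⁻₁ : ∀ {A B} → Γ ⊢ᵖʳᵏ (A ∨ B) ⁻ → Γ ⊢ᵖʳᵏ A ⊖
  E∨⁻₂ : ∀ {A B} → Γ ⊢ᵖʳᵏ (A ∨ B) ⁻ → Γ ⊢ᵖʳᵏ B ⊖
  I∨⁺₁ : ∀ {A B} → Γ ⊢ᵖʳᵏ A ⊕ → Γ ⊢ᵖʳᵏ (A ∨ B) ⁺
  I∨⁺₂ : ∀ {A B} → Γ ⊢ᵖʳᵏ B ⊕ → Γ ⊢ᵖʳᵏ (A ∨ B) ⁺
  I∧⁻₁ : ∀ {A B} → Γ ⊢ᵖʳᵏ A ⊖ → Γ ⊢ᵖʳᵏ (A ∧ B) ⁻
  I∧⁻₂ : ∀ {A B} → Γ ⊢ᵖʳᵏ B ⊖ → Γ ⊢ᵖʳᵏ (A ∧ B) ⁻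
  E∨⁺  : ∀ {A B P} → Γ ⊢ᵖʳᵏ (A ∨ B) ⁺ →
         A ⊕ ∷ Γ ⊢ᵖʳᵏ P → B ⊕ ∷ Γ ⊢ᵖʳᵏ P → Γ ⊢ᵖʳᵏ P
  E∧⁻  : ∀ {A B P} → Γ ⊢ᵖʳᵏ (A ∧ B) ⁻ →
         A ⊖ ∷ Γ ⊢ᵖʳᵏ P → B ⊖ ∷ Γ ⊢ᵖʳᵏ P → Γ ⊢ᵖʳᵏ P
  I¬⁺  : ∀ {A} → Γ ⊢ᵖʳᵏ A ⊖ → Γ ⊢ᵖʳᵏ (¬ A) ⁺
  I¬⁻  : ∀ {A} → Γ ⊢ᵖʳᵏ A ⊕ → Γ ⊢ᵖʳᵏ (¬ A) ⁻
  E¬⁺  : ∀ {A} → Γ ⊢ᵖʳᵏ (¬ A) ⁺ → Γ ⊢ᵖʳᵏ A ⊖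
  E¬⁻  : ∀ {A} → Γ ⊢ᵖʳᵏ (¬ A) ⁻ → Γ ⊢ᵖʳᵏ A ⊕
  IC⁺  : ∀ {A} → A ⊖ ∷ Γ ⊢ᵖʳᵏ A ⁺ → Γ ⊢ᵖʳᵏ A ⊕
  IC⁻  : ∀ {A} → A ⊕ ∷ Γ ⊢ᵖʳᵏ A ⁻ → Γ ⊢ᵖʳᵏ A ⊖
  EC⁺  : ∀ {A} → Γ ⊢ᵖʳᵏ A ⊕ → Γ ⊢ᵖʳᵏ A ⊖ → Γ ⊢ᵖʳᵏ A ⁺
  EC⁻  : ∀ {A} → Γ ⊢ᵖʳᵏ A ⊖ → Γ ⊢ᵖʳᵏ A ⊕ → Γ ⊢ᵖʳᵏ A ⁻

{-# OPTIONS --safe #-}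

-- Classical propositions of PRK satisfy reductio ad absurdum: if A⊖ entails
-- A⊕ then A⊕ holds outright, and dually; moreover A⊕ and A⊖ together entail
-- everything, and each strong proposition entails its classical version. So an
-- introduction rule for A is the strong one followed by this last step, and an
-- elimination rule with conclusion C⊕ assumes C⊖ and refutes the major premise
-- by the opposite introduction rule.
module Submission where

open import Defs
open import Data.List.Base using (List; _∷_; map)
open import Data.List.Membership.Propositional.Properties using (∈-map⁺)
open import Data.List.Relation.Binary.Subset.Propositional using (_⊆_)
open import Data.List.Relation.Binary.Subset.Propositional.Properties
  using (∷⁺ʳ; xs⊆x∷xs)
open import Data.List.Relation.Unary.Any using (here; there)
open import Relation.Binary.PropositionalEquality using (refl)

private
  variable
    Γ Δ : List Proposition
    P Q : Proposition
    A B C : Pure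

⊢-mono : Γ ⊆ Δ → Γ ⊢ᵖʳᵏ P → Δ ⊢ᵖʳᵏ P
⊢-mono s (ax p)       = ax (s p)
⊢-mono s (abs st d e) = abs st (⊢-mono s d) (⊢-mono s e)
⊢-mono s (I∧⁺ d e)    = I∧⁺ (⊢-mono s d) (⊢-mono s e)
⊢-mono s (I∨⁻ d e)    = I∨⁻ (⊢-mono s d) (⊢-mono s e)
⊢-mono s (E∧⁺₁ d)     = E∧⁺₁ (⊢-mono s d)
⊢-mono s (E∧⁺₂ d)     = E∧⁺₂ (⊢-mono s d)
⊢-mono s (E∨⁻₁ d)     = E∨⁻₁ (⊢-mono s d)
⊢-mono s (E∨⁻₂ d)     = E∨⁻₂ (⊢-mono s d)
⊢-mono s (I∨⁺₁ d)     = I∨⁺₁ (⊢-mono s d)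
⊢-mono s (I∨⁺₂ d)     = I∨⁺₂ (⊢-mono s d)
⊢-mono s (I∧⁻₁ d)     = I∧⁻₁ (⊢-mono s d)
⊢-mono s (I∧⁻₂ d)     = I∧⁻₂ (⊢-mono s d)
⊢-mono s (E∨⁺ d e f)  = E∨⁺ (⊢-mono s d) (⊢-mono (∷⁺ʳ _ s) e) (⊢-mono (∷⁺ʳ _ s) f)
⊢-mono s (E∧⁻ d e f)  = E∧⁻ (⊢-mono s d) (⊢-mono (∷⁺ʳ _ s) e) (⊢-mono (∷⁺ʳ _ s) f)
⊢-mono s (I¬⁺ d)      = I¬⁺ (⊢-mono s d)
⊢-mono s (I¬⁻ d)      = I¬⁻ (⊢-mono s d)
⊢-mono s (E¬⁺ d)      = E¬⁺ (⊢-mono s d)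
⊢-mono s (E¬⁻ d)      = E¬⁻ (⊢-mono s d)
⊢-mono s (IC⁺ d)      = IC⁺ (⊢-mono (∷⁺ʳ _ s) d)
⊢-mono s (IC⁻ d)      = IC⁻ (⊢-mono (∷⁺ʳ _ s) d)
⊢-mono s (EC⁺ d e)    = EC⁺ (⊢-mono s d) (⊢-mono s e)
⊢-mono s (EC⁻ d e)    = EC⁻ (⊢-mono s d) (⊢-mono s e)

weaken : Γ ⊢ᵖʳᵏ P → Q ∷ Γ ⊢ᵖʳᵏ P
weaken = ⊢-mono (xs⊆x∷xs _ _)

weaken₁ : ∀ {R} → P ∷ Γ ⊢ᵖʳᵏ Q → P ∷ R ∷ Γ ⊢ᵖʳᵏ Q
weaken₁ = ⊢-mono (∷⁺ʳ _ (xs⊆x∷xs _ _))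

hyp₀ : P ∷ Γ ⊢ᵖʳᵏ P
hyp₀ = ax (here refl)

hyp₁ : Q ∷ P ∷ Γ ⊢ᵖʳᵏ P
hyp₁ = ax (there (here refl))

-- `abs` accepts only strong propositions, so `EC⁺` and `EC⁻` first turn the classical pair into the
-- strong pair `A ⁺`, `A ⁻`.
⊕⊖-contradiction : Γ ⊢ᵖʳᵏ A ⊕ → Γ ⊢ᵖʳᵏ A ⊖ → Γ ⊢ᵖʳᵏ Q
⊕⊖-contradiction d e = abs strong⁺ (EC⁺ d e) (EC⁻ e d)

⁺⇒⊕ : Γ ⊢ᵖʳᵏ A ⁺ → Γ ⊢ᵖʳᵏ A ⊕
⁺⇒⊕ d = IC⁺ (weaken d)

⁻⇒⊖ : Γ ⊢ᵖʳᵏ A ⁻ → Γ ⊢ᵖʳᵏ A ⊖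
⁻⇒⊖ d = IC⁻ (weaken d)

-- Under the assumed `A ⊖`, `EC⁺` plays the derived `A ⊕` against that assumption to produce the
-- `A ⁺` that `IC⁺` demands.
raa-⊕ : A ⊖ ∷ Γ ⊢ᵖʳᵏ A ⊕ → Γ ⊢ᵖʳᵏ A ⊕
raa-⊕ d = IC⁺ (EC⁺ d hyp₀)

raa-⊖ : A ⊕ ∷ Γ ⊢ᵖʳᵏ A ⊖ → Γ ⊢ᵖʳᵏ A ⊖
raa-⊖ d = IC⁻ (EC⁻ d hyp₀)

∧E₁-⊕ : Γ ⊢ᵖʳᵏ (A ∧ B) ⊕ → Γ ⊢ᵖʳᵏ A ⊕
∧E₁-⊕ d = raa-⊕ (⊕⊖-contradiction (weaken d) (⁻⇒⊖ (I∧⁻₁ hyp₀)))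

∧E₂-⊕ : Γ ⊢ᵖʳᵏ (A ∧ B) ⊕ → Γ ⊢ᵖʳᵏ B ⊕
∧E₂-⊕ d = raa-⊕ (⊕⊖-contradiction (weaken d) (⁻⇒⊖ (I∧⁻₂ hyp₀)))

∨E-⊕ : Γ ⊢ᵖʳᵏ (A ∨ B) ⊕ → A ⊕ ∷ Γ ⊢ᵖʳᵏ C ⊕ → B ⊕ ∷ Γ ⊢ᵖʳᵏ C ⊕ → Γ ⊢ᵖʳᵏ C ⊕
∨E-⊕ {Γ} {C = C} d e f =
  raa-⊕ (⊕⊖-contradiction (weaken d) (⁻⇒⊖ (I∨⁻ (refute e) (refute f))))
  where
  refute : ∀ {D} → D ⊕ ∷ Γ ⊢ᵖʳᵏ C ⊕ → C ⊖ ∷ Γ ⊢ᵖʳᵏ D ⊖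
  -- `hyp₁` is the assumed `C ⊖`; it clashes with the `C ⊕` that `g` draws from `D ⊕`.
  refute g = raa-⊖ (⊕⊖-contradiction (weaken₁ g) hyp₁)

¬E-⊕ : Γ ⊢ᵖʳᵏ A ⊕ → Γ ⊢ᵖʳᵏ (¬ A) ⊕ → Γ ⊢ᵖʳᵏ P
¬E-⊕ d e = ⊕⊖-contradiction e (⁻⇒⊖ (I¬⁻ d))

¬I-⊕ : A ⊕ ∷ Γ ⊢ᵖʳᵏ A ⊖ → Γ ⊢ᵖʳᵏ (¬ A) ⊕
¬I-⊕ d = ⁺⇒⊕ (I¬⁺ (raa-⊖ d))

lem-⊕ : Γ ⊢ᵖʳᵏ (A ∨ ¬ A) ⊕
-- Assume `(A ∨ ¬ A) ⊖` and aim for the right disjunct: `A ⊕` would give the left one, contradicting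
-- the assumption `hyp₁`.
lem-⊕ = raa-⊕ (⁺⇒⊕ (I∨⁺₂ (¬I-⊕ (⊕⊖-contradiction (⁺⇒⊕ (I∨⁺₁ hyp₀)) hyp₁))))

theorem39 : (As : List Pure) (B : Pure) → As ⊢ᶜ B → map _⊕ As ⊢ᵖʳᵏ B ⊕
theorem39 As B (ax p)     = ax (∈-map⁺ _⊕ p)
theorem39 As _ (∧I d e)   = ⁺⇒⊕ (I∧⁺ (theorem39 As _ d) (theorem39 As _ e))
theorem39 As _ (∧E₁ d)    = ∧E₁-⊕ (theorem39 As _ d)
theorem39 As _ (∧E₂ d)    = ∧E₂-⊕ (theorem39 As _ d)
theorem39 As _ (∨I₁ d)    = ⁺⇒⊕ (I∨⁺₁ (theorem39 As _ d))
theorem39 As _ (∨I₂ d)    = ⁺⇒⊕ (I∨⁺₂ (theorem39 As _ d))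
theorem39 As _ (∨E d e f) =
  ∨E-⊕ (theorem39 As _ d) (theorem39 (_ ∷ As) _ e) (theorem39 (_ ∷ As) _ f)
theorem39 As _ (¬I d e)   =
  -- The clash between `B ⊕` and `(¬ B) ⊕` is used to conclude `A ⊖`, the premise of `I¬⁺` after
  -- `raa-⊖`.
  ¬I-⊕ (¬E-⊕ (theorem39 (_ ∷ As) _ d) (theorem39 (_ ∷ As) _ e))
theorem39 As _ (¬E d e)   = ¬E-⊕ (theorem39 As _ d) (theorem39 As _ e)
theorem39 As _ lem        = lem-⊕
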